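{- For a positive integer $\ell$, let $T_\ell^\delta$ denote the full $\delta$-ary tree of depth $\ell$. Let $n$ be the smallest positive integer (assumed to exist) such that there exist $\delta+1$ outer multiset bases $S_1,\ldots,S_{\delta+1}$ of $T_n^\delta$ satisfying, for all $i\ne j$ in $\{1,\ldots,\delta+1\}$, $$\operatorname{m}_{T_n^\delta}(w|S_i)[\epsilon_{T_n^\delta}(w)]\neq \operatorname{m}_{T_n^\delta}(w|S_j)[\epsilon_{T_n^\delta}(w)],$$ where $w$ is the root of $T_n^\delta$. Then, for every $\ell\ge n$, the outer multiset dimension of $T_\ell^\delta$ is given by $$\dim_{ms}(T_\ell^\delta)=\delta^{\ell-n}\times\dim_{ms}(T_n^\delta).$$
   Context: For a simple connected graph $G=(V,E)$, $d_G(u,v)$ is the length of a shortest $u$–$v$ path. For $S=\{w_1,\ldots,w_t\}\subseteq V$ and $u\in V$, the multiset representation of $u$ with respect to $S$ is the multiset $\operatorname{m}_G(u|S)$ consisting of $d_G(u,w_1),\ldots,d_G(u,w_t)$, counted with multiplicity. A set $S\subseteq V$ is an outer multiset resolving set of $G$ if $\operatorname{m}_G(u|S)\ne \operatorname{m}_G(v|S)$ for every two distinct vertices $u,v\in V\setminus S$. The outer multiset dimension $\dim_{ms}(G)$ is the minimum cardinality of an outer multiset resolving set of $G$, and an outer multiset basis is an outer multiset resolving set of minimum cardinality. For a multiset $M$ and an element $x$, $M[x]$ denotes the multiplicity of $x$ in $M$. $\epsilon_G(x)$ denotes the eccentricity of the vertex $x$ in $G$, i.e. the largest distance from $x$ to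 any vertex of $G$. A full $\delta$-ary tree is a rooted tree whose root has degree $\delta$, all of whose leaves are at the same distance from the root (this distance is the depth), and in which every vertex other than the root is either a leaf or a vertex of degree $\delta+1$. -}

module Defs where

open import Data.Fin using (Fin)
open import Data.Fin.Properties using (any?) renaming (_≟_ to _≟ᶠ_)
open import Data.Fin.Subset using (Subset; _∈_; _∉_; ∣_∣; ⊤)
open import Data.Fin.Subset.Properties using (_∈?_; anySubset?; ∈⊤)
open import Data.List using (List; []; _∷_; map; filter; length; head; last; allFin)
open import Data.List.Extrema.Nat using (max)
import Data.List.Membership.DecPropositional as DecMembership
open import Data.List.Membership.Propositional.Properties using (∈-∃++)
open import Data.List.Relation.Binary.Permutation.Propositional
  using (_↭_; refl; prep; ↭-sym; ↭-trans)
open import Data.List.Relation.Binary.Permutation.Propositional.Properties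
  using (∈-resp-↭; shift; drop-∷; ¬x∷xs↭[])
open import Data.List.Relation.Unary.Any using (here)
open import Data.List.Relation.Unary.Linked using (Linked; linked?)
open import Data.List.Relation.Unary.Unique.Propositional using (Unique)
import Data.List.Relation.Unary.Unique.DecPropositional as DecUnique
open import Data.Maybe using (just)
open import Data.Maybe.Properties using (≡-dec)
open import Data.Nat using (ℕ; zero; suc; _≤_; z≤n; s≤s; _≟_)
open import Data.Nat.Properties using (suc-injective)
open import Data.Product using (Σ; ∃; ∃-syntax; _×_; _,_; proj₁; proj₂)
open import Data.Sum using (_⊎_)
open import Data.Empty using (⊥-elim)
open import Function using (_∘_)
open import Level using (Level; 0ℓ)
open import Relation.Binary using (Rel; Symmetric; Irreflexive; Decidable)
open import Relation.Binary.PropositionalEquality using (_≡_; _≢_; refl; cong; sym)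
open import Relation.Nullary using (¬_; Dec; yes; no)
open import Relation.Nullary.Decidable using (map′; _×-dec_; _→-dec_; ¬?)
import Relation.Unary as U

private
  variable
    p : Level

IsMinimum : (ℕ → Set p) → ℕ → Set p
IsMinimum P m = P m × (∀ {k} → P k → m ≤ k)

minimum : {P : ℕ → Set p} → U.Decidable P → ∃ P → ∃ (IsMinimum P)
minimum {P = P} P? (k , pk) = search k P? pk
  where
  search : ∀ k {P : ℕ → Set _} → U.Decidable P → P k → ∃ (IsMinimum P)
  search zero    P? pk = zero , pk , λ _ → z≤n
  search (suc k) P? pk with P? zero
  ... | yes p0 = zero , p0 , λ _ → z≤n
  ... | no ¬p0 with search k (P? ∘ suc) pk
  ...   | m , pm , least = suc m , pm ,
          λ { {zero} p0 → ⊥-elim (¬p0 p0) ; {suc _} pj → s≤s (least pj) }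

-- Finite multisets of naturals are lists up to permutation _↭_.
Multiset : Set
Multiset = List ℕ

infix 10 _⟦_⟧

_⟦_⟧ : Multiset → ℕ → ℕ
M ⟦ x ⟧ = length (filter (x ≟_) M)

_↭?_ : Decidable (_↭_ {A = ℕ})
[]       ↭? []       = yes refl
[]       ↭? (y ∷ ys) = no (¬x∷xs↭[] ∘ ↭-sym)
(x ∷ xs) ↭? ys with DecMembership._∈?_ _≟_ x ys
... | no  x∉ys = no λ q → x∉ys (∈-resp-↭ q (here refl))
... | yes x∈ys with ∈-∃++ x∈ys
...   | as , bs , refl = map′
          (λ q → ↭-trans (prep x q) (↭-sym (shift x as bs)))
          (λ q → drop-∷ (↭-trans q (shift x as bs)))
          (xs ↭? _)

module Paths {n : ℕ} (_~_ : Rel (Fin n) 0ℓ) where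

  -- A path is given by the list of its vertices, both ends included.
  record IsPath (u v : Fin n) (xs : List (Fin n)) : Set where
    constructor isPath
    field
      starts   : head xs ≡ just u
      ends     : last xs ≡ just v
      adjacent : Linked _~_ xs
      distinct : Unique xs

  PathOfLength : Fin n → Fin n → ℕ → Set
  PathOfLength u v k = ∃[ xs ] IsPath u v xs × length xs ≡ suc k

-- Finite simple connected graphs.
record Graph : Set₁ where
  field
    order : ℕ

  V : Set
  V = Fin order

  field
    _~_       : Rel V 0ℓ
    _~?_      : Decidable _~_
    symmetric : Symmetric _~_
    loopless  : Irreflexive _≡_ _~_

  open Paths _~_ public

  field
    connected : ∀ u v → ∃[ k ] PathOfLength u v k

  isPath? : ∀ u v → U.Decidable (IsPath u v)
  isPath? u v xs = map′
    (λ (a , b , c , d) → isPath a b c d)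
    (λ (isPath a b c d) → a , b , c , d)
    (≡-dec _≟ᶠ_ (head xs) (just u) ×-dec ≡-dec _≟ᶠ_ (last xs) (just v)
      ×-dec linked? _~?_ xs ×-dec DecUnique.unique? _≟ᶠ_ xs)

  anyListOfLength? : ∀ k {P : List V → Set} → U.Decidable P →
                     Dec (∃[ xs ] P xs × length xs ≡ k)
  anyListOfLength? zero P? = map′
    (λ p → [] , p , refl)
    (λ { ([] , p , _) → p })
    (P? [])
  anyListOfLength? (suc k) P? = map′
    (λ (x , xs , p , eq) → x ∷ xs , p , cong suc eq)
    (λ { (x ∷ xs , p , eq) → x , xs , p , suc-injective eq })
    (any? λ x → anyListOfLength? k (P? ∘ (x ∷_)))

  pathOfLength? : ∀ u v → U.Decidable (PathOfLength u v)
  pathOfLength? u v k = anyListOfLength? (suc k) (isPath? u v)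

  d-minimum : ∀ u v → ∃ (IsMinimum (PathOfLength u v))
  d-minimum u v = minimum (pathOfLength? u v) (connected u v)

  d : V → V → ℕ
  d u v = proj₁ (d-minimum u v)

  degree : V → ℕ
  degree u = length (filter (u ~?_) (allFin order))

  ε : V → ℕ
  ε u = max 0 (map (d u) (allFin order))

  elements : Subset order → List V
  elements S = filter (_∈? S) (allFin order)

  m⟨_∣_⟩ : V → Subset order → Multiset
  m⟨ u ∣ S ⟩ = map (d u) (elements S)

  OuterMultisetResolving : Subset order → Set
  OuterMultisetResolving S =
    ∀ u v → u ∉ S → v ∉ S → u ≢ v → ¬ (m⟨ u ∣ S ⟩ ↭ m⟨ v ∣ S ⟩)

  outerMultisetResolving? : U.Decidable OuterMultisetResolving
  outerMultisetResolving? S = all? λ u → all? λ v →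
    ¬? (u ∈? S) →-dec ¬? (v ∈? S) →-dec ¬? (u ≟ᶠ v) →-dec
    ¬? (m⟨ u ∣ S ⟩ ↭? m⟨ v ∣ S ⟩)
    where open import Data.Fin.Properties using (all?)

  ResolvingOfSize : ℕ → Set
  ResolvingOfSize k = ∃[ S ] OuterMultisetResolving S × ∣ S ∣ ≡ k

  dimₘₛ-minimum : ∃ (IsMinimum ResolvingOfSize)
  dimₘₛ-minimum = minimum
    (λ k → anySubset? λ S → outerMultisetResolving? S ×-dec (∣ S ∣ ≟ k))
    (∣ ⊤ {order} ∣ , ⊤ , (λ _ _ u∉⊤ → ⊥-elim (u∉⊤ ∈⊤)) , refl)

  dimₘₛ : ℕ
  dimₘₛ = proj₁ dimₘₛ-minimum

  OuterMultisetBasis : Subset order → Set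
  OuterMultisetBasis S = OuterMultisetResolving S × ∣ S ∣ ≡ dimₘₛ

  -- Any two vertices are joined by exactly one path (existence is `connected`).
  IsTree : Set
  IsTree = ∀ {u v xs ys} → IsPath u v xs → IsPath u v ys → xs ≡ ys

record RootedGraph : Set₁ where
  field
    graph : Graph
  open Graph graph public
  field
    root : V

-- The root is never a leaf, even when δ = 1 and its degree is 1.
-- `leaf-exists` makes the depth well defined; it fails only for δ = 0, where
-- the graph is a single vertex.
record IsFullTree (δ ℓ : ℕ) (T : RootedGraph) : Set where
  open RootedGraph T

  Leaf : V → Set
  Leaf v = v ≢ root × degree v ≡ 1

  field
    isTree      : IsTree
    root-degree : degree root ≡ δ
    leaf-exists : ∃ Leaf
    leaf-depth  : ∀ v → Leaf v → d root v ≡ ℓ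
    inner       : ∀ v → v ≢ root → Leaf v ⊎ degree v ≡ suc δ

HasDistinguishingBases : ℕ → RootedGraph → Set
HasDistinguishingBases δ T =
  Σ (Fin (suc δ) → Subset order) λ S →
    (∀ i → OuterMultisetBasis (S i)) ×
    (∀ i j → i ≢ j → m⟨ root ∣ S i ⟩ ⟦ ε root ⟧ ≢ m⟨ root ∣ S j ⟩ ⟦ ε root ⟧)
  where open RootedGraph T

{-# OPTIONS --safe #-}

-- A vertex u of T_ℓ sees its farthest vertices at distance ℓ + depth u, and for
-- δ ≥ 2 a resolving set contains one of these (two sibling leaves outside it would
-- not be distinguished). Hence vertices of different depths are never confused, and
-- for vertices of equal depth in the same branch of T_(ℓ+1) everything outside the
-- branch contributes equally. So the restrictions of a resolving set of T_(ℓ+1) to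
-- the δ branches resolve T_ℓ, whence dim T_(ℓ+1) ≥ δ dim T_ℓ.
-- Conversely, put δ of the δ + 1 given bases into the branches, omitting the k-th.
-- Vertices of equal depth in different branches are separated by the multiplicity of
-- their eccentricity, which counts the chosen leaves outside the own branch. As k
-- varies, the total number of chosen leaves varies too, so the δ + 1 bases obtained
-- satisfy the hypothesis again.
-- Since paths in a tree are unique, a full tree is isometric to the tree of words of
-- length at most ℓ over Fin δ, where all of this is computed.

module Submission where

open import Defs
open import Data.Nat.Properties
open import Algebra.Properties.CommutativeMonoid.Sum +-0-commutativeMonoid
  using (sum; sum-remove; sum-cong-≗)
open import Data.Bool using (Bool; true; false; if_then_else_)
open import Data.Bool.Properties using (¬-not) renaming (_≟_ to _≟ᵇ_)
open import Data.Empty using (⊥; ⊥-elim)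
open import Data.Fin using (Fin; zero; suc; fromℕ<; punchIn)
open import Data.Fin.Properties using (injective⇒≤; punchIn-injective; punchInᵢ≢i)
  renaming (_≟_ to _≟ᶠ_; suc-injective to suc-injectiveᶠ)
open import Data.Fin.Subset using (Subset; ∣_∣) renaming (_∉_ to _∉ˢ_)
open import Data.Fin.Subset.Properties using () renaming (_∈?_ to _∈ˢ?_)
open import Data.List
  using (List; []; _∷_; [_]; _++_; _∷ʳ_; map; concat; filter; length; lookup; tabulate;
         head; last; reverse; allFin)
open import Data.List.Extrema.Nat using (max≈v⁺)
import Data.List.Membership.DecPropositional as DecMembership
open import Data.List.Membership.Propositional using (_∈_; _∉_)
open import Data.List.Membership.Propositional.Properties
  using (∈-map⁺; ∈-map⁻; ∈-++⁺ˡ; ∈-++⁺ʳ; ∈-++⁻; ∈-concat⁺′; ∈-concat⁻′; ∈-tabulate⁺; ∈-tabulate⁻;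
         ∈-filter⁺; ∈-filter⁻; ∈-allFin; ∈-length; ∈-lookup)
open import Data.List.Membership.Propositional.Properties.WithK using (unique∧set⇒bag)
open import Data.List.Properties
  using (map-++; concat-map; map-tabulate; tabulate-cong; map-∘; map-cong; length-++; length-map;
         length-reverse; unfold-reverse; ++-assoc; ++-cancelʳ; ∷-injectiveˡ; ∷ʳ-injectiveʳ;
         filter-++; filter-all; filter-none; filter-accept; filter-reject)
open import Data.List.Relation.Binary.BagAndSetEquality using (∼bag⇒↭)
open import Data.List.Relation.Binary.Disjoint.Propositional using (Disjoint)
open import Data.List.Relation.Binary.Permutation.Propositional
  using (_↭_; ↭-sym; ↭-trans; ↭-reflexive; ↭⇒↭ₛ)
open import Data.List.Relation.Binary.Permutation.Propositional.Properties
  using (++⁺; ++⁺ˡ; ++-comm; map⁺; drop-∷; filter-↭; ↭-length; ↭-reverse; ↭-singleton-inv;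
         ∈-resp-↭)
import Data.List.Relation.Binary.Permutation.Setoid.Properties as PermSetoid
open import Data.List.Relation.Unary.All as All using (All; []; _∷_)
import Data.List.Relation.Unary.All.Properties as Allₚ
open import Data.List.Relation.Unary.AllPairs using ([]; _∷_)
import Data.List.Relation.Unary.AllPairs.Properties as AllPairsₚ
open import Data.List.Relation.Unary.Any using (here; there; index)
open import Data.List.Relation.Unary.Any.Properties using (lookup-index)
open import Data.List.Relation.Unary.Linked using (Linked; [-]; _∷_)
open import Data.List.Relation.Unary.Unique.Propositional using (Unique)
import Data.List.Relation.Unary.Unique.Propositional.Properties as Uniqueₚ
open import Data.Maybe using (just)
open import Data.Nat using (ℕ; zero; suc; _+_; _≤_; _<_; _*_; _^_; _∸_; z≤n; s≤s; _≟_)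
open import Data.Product using (∃-syntax; _×_; _,_; proj₁; proj₂)
open import Data.Sum using (inj₁; inj₂)
open import Data.Vec using ([]; _∷_) renaming (lookup to lookupᵛ; tabulate to tabulateᵛ)
open import Data.Vec.Properties using (lookup∘tabulate; lookup⇒[]=; []=⇒lookup)
open import Function using (_∘_; case_of_; mk⇔)
open import Relation.Binary using (tri<; tri≈; tri>)
open import Relation.Binary.PropositionalEquality
  using (_≡_; _≢_; refl; sym; trans; cong; cong₂; subst; subst₂; setoid; module ≡-Reasoning)
open import Relation.Nullary using (¬_; yes; no; does)
open import Relation.Nullary.Decidable using (¬?; dec-true; dec-false)
import Relation.Unary as U
open RootedGraph using (dimₘₛ)

private
  variable
    A B : Set
    R : A → A → Set
    δ ℓ m n D : ℕ
    u v w : A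
    xs ys : List A

-- Permutations and multiplicities

++-cancelˡ-↭ : (xs : List A) {ys zs : List A} → xs ++ ys ↭ xs ++ zs → ys ↭ zs
++-cancelˡ-↭ []       p = p
++-cancelˡ-↭ (x ∷ xs) p = ++-cancelˡ-↭ xs (drop-∷ p)

++-cancelʳ-↭ : (zs : List A) {xs ys : List A} → xs ++ zs ↭ ys ++ zs → xs ↭ ys
++-cancelʳ-↭ zs {xs} {ys} p =
  ++-cancelˡ-↭ zs (↭-trans (++-comm zs xs) (↭-trans p (++-comm ys zs)))

concat-tabulate-↭⁺ : {g h : Fin n → List A} (i : Fin n) → (∀ j → j ≢ i → g j ≡ h j) →
                     g i ↭ h i → concat (tabulate g) ↭ concat (tabulate h)
concat-tabulate-↭⁺ {h = h} zero eq p =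
  ++⁺ p (↭-reflexive (cong concat (tabulate-cong λ j → eq (suc j) λ ())))
concat-tabulate-↭⁺ (suc i) eq p = ++⁺ (↭-reflexive (eq zero λ ()))
  (concat-tabulate-↭⁺ i (λ j j≢i → eq (suc j) (j≢i ∘ suc-injectiveᶠ)) p)

-- Multiset union is cancellative, so the equal blocks on either side of block i can be stripped off
-- one by one.
concat-tabulate-↭⁻ : {g h : Fin n → List A} (i : Fin n) → (∀ j → j ≢ i → g j ≡ h j) →
                     concat (tabulate g) ↭ concat (tabulate h) → g i ↭ h i
concat-tabulate-↭⁻ {g = g} {h} zero eq p = ++-cancelʳ-↭ (concat (tabulate (h ∘ suc)))
  (subst (λ xss → g zero ++ concat xss ↭ _) (tabulate-cong λ j → eq (suc j) λ ()) p)
concat-tabulate-↭⁻ {g = g} {h} (suc i) eq p =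
  concat-tabulate-↭⁻ i (λ j j≢i → eq (suc j) (j≢i ∘ suc-injectiveᶠ)) (++-cancelˡ-↭ (h zero)
    (subst (λ xs → xs ++ concat (tabulate (g ∘ suc)) ↭ _) (eq zero λ ()) p))

⟦⟧-↭ : ∀ {xs ys} k → xs ↭ ys → xs ⟦ k ⟧ ≡ ys ⟦ k ⟧
⟦⟧-↭ k p = ↭-length (filter-↭ (k ≟_) p)

⟦⟧-++ : ∀ xs ys k → (xs ++ ys) ⟦ k ⟧ ≡ xs ⟦ k ⟧ + ys ⟦ k ⟧
⟦⟧-++ xs ys k = trans (cong length (filter-++ (k ≟_) xs ys)) (length-++ (filter (k ≟_) xs))

⟦⟧-concat-tabulate : (g : Fin n → List ℕ) → ∀ k →
                     concat (tabulate g) ⟦ k ⟧ ≡ sum (λ i → g i ⟦ k ⟧)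
⟦⟧-concat-tabulate {zero}  g k = refl
⟦⟧-concat-tabulate {suc n} g k =
  trans (⟦⟧-++ (g zero) _ k) (cong (g zero ⟦ k ⟧ +_) (⟦⟧-concat-tabulate (g ∘ suc) k))

⟦⟧-bounded : ∀ {xs k} → All (_< k) xs → xs ⟦ k ⟧ ≡ 0
⟦⟧-bounded {xs} {k} xs<k =
  cong length (filter-none (k ≟_) (All.map (λ x<k k≡x → <-irrefl (sym k≡x) x<k) xs<k))

⟦⟧-map : {f : ℕ → ℕ} → (∀ {x y} → f x ≡ f y → x ≡ y) → ∀ xs k → map f xs ⟦ f k ⟧ ≡ xs ⟦ k ⟧
⟦⟧-map         f-inj []       k = refl
⟦⟧-map {f = f} f-inj (x ∷ xs) k with k ≟ x
... | yes refl = trans (cong length (filter-accept (f k ≟_) {xs = map f xs} refl))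
  (trans (cong suc (⟦⟧-map f-inj xs k)) (sym (cong length (filter-accept (k ≟_) {xs = xs} refl))))
... | no k≢x = trans (cong length (filter-reject (f k ≟_) {xs = map f xs} (k≢x ∘ f-inj)))
  (trans (⟦⟧-map f-inj xs k) (sym (cong length (filter-reject (k ≟_) {xs = xs} k≢x))))

length-concat-tabulate : (g : Fin n → List A) →
                         length (concat (tabulate g)) ≡ sum (length ∘ g)
length-concat-tabulate {zero}  g = refl
length-concat-tabulate {suc n} g =
  trans (length-++ (g zero)) (cong (length (g zero) +_) (length-concat-tabulate (g ∘ suc)))

sum-lower : {f : Fin n → ℕ} → (∀ i → D ≤ f i) → n * D ≤ sum f
sum-lower {zero}  D≤f = z≤n
sum-lower {suc n} D≤f = +-mono-≤ (D≤f zero) (sum-lower (D≤f ∘ suc))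

sum-const : {f : Fin n → ℕ} → (∀ i → f i ≡ D) → sum f ≡ n * D
sum-const {zero}  f≡D = refl
sum-const {suc n} f≡D = cong₂ _+_ (f≡D zero) (sum-const (f≡D ∘ suc))

-- The model tree

-- The index bounds the length of the word rather than fixing it, so `i ▸_` embeds the tree of depth
-- m as the i-th branch of the tree of depth `suc m`.
data Node (δ : ℕ) : ℕ → Set where
  top : Node δ m
  _▸_ : Fin δ → Node δ m → Node δ (suc m)

infixr 5 _▸_

depth : Node δ m → ℕ
depth top     = 0
depth (_ ▸ u) = suc (depth u)

-- A common prefix is stripped at no cost; after it the path climbs to the last common ancestor and
-- descends again.
dist : Node δ m → Node δ m → ℕ
dist top     v       = depth v
dist (i ▸ u) top     = suc (depth u)
dist (i ▸ u) (j ▸ v) = if does (i ≟ᶠ j) then dist u v else suc (depth u) + suc (depth v)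

dist-same : (i : Fin δ) (u v : Node δ m) → dist (i ▸ u) (i ▸ v) ≡ dist u v
dist-same i u v rewrite dec-true (i ≟ᶠ i) refl = refl

dist-diff : {i j : Fin δ} → i ≢ j → (u v : Node δ m) →
            dist (i ▸ u) (j ▸ v) ≡ suc (depth u) + suc (depth v)
dist-diff {i = i} {j} i≢j u v rewrite dec-false (i ≟ᶠ j) i≢j = refl

depth≤ : (u : Node δ m) → depth u ≤ m
depth≤ top     = z≤n
depth≤ (_ ▸ u) = s≤s (depth≤ u)

dist≤ : (u v : Node δ m) → dist u v ≤ depth u + depth v
dist≤ top     v       = ≤-refl
dist≤ (i ▸ u) top     = ≤-reflexive (sym (+-identityʳ _))
dist≤ (i ▸ u) (j ▸ v) with i ≟ᶠ j
... | yes _ = ≤-trans (dist≤ u v) (+-mono-≤ (n≤1+n _) (n≤1+n _))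
... | no  _ = ≤-refl

dist≤depth+m : (u v : Node δ m) → dist u v ≤ depth u + m
dist≤depth+m u v = ≤-trans (dist≤ u v) (+-monoʳ-≤ (depth u) (depth≤ v))

-- Vertex sets of the model and their multiset representations

NodeSet : ℕ → ℕ → Set
NodeSet δ m = Node δ m → Bool

infixl 6 _∣▸_
_∣▸_ : NodeSet δ (suc m) → Fin δ → NodeSet δ m
(s ∣▸ i) u = s (i ▸ u)

topElem : NodeSet δ m → List (Node δ m)
topElem s = if s top then [ top ] else []

elems : NodeSet δ m → List (Node δ m)
elems {m = zero}  s = topElem s
elems {m = suc m} s = topElem s ++ concat (tabulate λ i → map (i ▸_) (elems (s ∣▸ i)))

size : NodeSet δ m → ℕ
size s = length (elems s)

rep : Node δ m → NodeSet δ m → List ℕ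
rep u s = map (dist u) (elems s)

-- The vertices at distance m from `top` are those on the lowest level, so this is the multiplicity
-- that the given bases must keep apart.
leaves : NodeSet δ m → ℕ
leaves {m = m} s = rep top s ⟦ m ⟧

∈-branches⁻ : (xs : Fin δ → List (Node δ m)) {u : Node δ (suc m)} →
              u ∈ concat (tabulate λ i → map (i ▸_) (xs i)) →
              ∃[ i ] ∃[ v ] v ∈ xs i × u ≡ i ▸ v
∈-branches⁻ xs u∈ with ∈-concat⁻′ (tabulate λ i → map (i ▸_) (xs i)) u∈
... | _ , u∈i , i∈ with ∈-tabulate⁻ {f = λ i → map (i ▸_) (xs i)} i∈
... | i , refl = i , ∈-map⁻ (i ▸_) u∈i

∈-topElem⁺ : (s : NodeSet δ m) → s top ≡ true → top ∈ topElem s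
∈-topElem⁺ s eq rewrite eq = here refl

∈-topElem⁻ : (s : NodeSet δ m) {u : Node δ m} → u ∈ topElem s → u ≡ top × s u ≡ true
∈-topElem⁻ s u∈ with s top in eq
∈-topElem⁻ s (here refl) | true = refl , eq

∈-elems⁺ : (s : NodeSet δ m) (u : Node δ m) → s u ≡ true → u ∈ elems s
∈-elems⁺ {m = zero}  s top     eq = ∈-topElem⁺ s eq
∈-elems⁺ {m = suc m} s top     eq = ∈-++⁺ˡ (∈-topElem⁺ s eq)
∈-elems⁺ {m = suc m} s (i ▸ u) eq =
  ∈-++⁺ʳ (topElem s) (∈-concat⁺′ (∈-map⁺ (i ▸_) (∈-elems⁺ (s ∣▸ i) u eq)) (∈-tabulate⁺ i))

∈-elems⁻ : (s : NodeSet δ m) {u : Node δ m} → u ∈ elems s → s u ≡ true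
∈-elems⁻ {m = zero}  s u∈ = proj₂ (∈-topElem⁻ s u∈)
∈-elems⁻ {m = suc m} s u∈ with ∈-++⁻ (topElem s) u∈
... | inj₁ u∈ˡ = proj₂ (∈-topElem⁻ s u∈ˡ)
... | inj₂ u∈ʳ with ∈-branches⁻ (λ i → elems (s ∣▸ i)) u∈ʳ
... | i , v , v∈ , refl = ∈-elems⁻ (s ∣▸ i) v∈

topElem-unique : (s : NodeSet δ m) → Unique (topElem s)
topElem-unique s with s top
... | true  = [] ∷ []
... | false = []

▸-injectiveˡ : {i j : Fin δ} {u v : Node δ m} → i ▸ u ≡ j ▸ v → i ≡ j
▸-injectiveˡ refl = refl

▸-injectiveʳ : {i j : Fin δ} {u v : Node δ m} → i ▸ u ≡ j ▸ v → u ≡ v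
▸-injectiveʳ refl = refl

elems-unique : (s : NodeSet δ m) → Unique (elems s)
elems-unique {m = zero}  s = topElem-unique s
elems-unique {δ} {m = suc m} s = Uniqueₚ.++⁺ (topElem-unique s)
  (Uniqueₚ.concat⁺
    (Allₚ.tabulate⁺ λ i → Uniqueₚ.map⁺ ▸-injectiveʳ (elems-unique (s ∣▸ i)))
    (AllPairsₚ.tabulate⁺ branches-disjoint))
  top-disjoint
  where
  branches-disjoint : ∀ {i j} {xs ys : List (Node δ m)} → i ≢ j →
                      Disjoint (map (i ▸_) xs) (map (j ▸_) ys)
  branches-disjoint {i} {j} i≢j (u∈i , u∈j) with ∈-map⁻ (i ▸_) u∈i | ∈-map⁻ (j ▸_) u∈j
  ... | _ , _ , refl | _ , _ , eq = i≢j (▸-injectiveˡ eq)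
  top-disjoint : Disjoint (topElem s) (concat (tabulate λ i → map (i ▸_) (elems (s ∣▸ i))))
  top-disjoint (u∈top , u∈) with ∈-topElem⁻ s u∈top
  ... | refl , _ with ∈-branches⁻ (λ i → elems (s ∣▸ i)) u∈
  ... | _ , _ , _ , ()

size-suc : (s : NodeSet δ (suc m)) → size s ≡ length (topElem s) + sum (λ i → size (s ∣▸ i))
size-suc s = trans (length-++ (topElem s)) (cong (length (topElem s) +_)
  (trans (length-concat-tabulate λ i → map (i ▸_) (elems (s ∣▸ i)))
         (sum-cong-≗ λ i → length-map (i ▸_) (elems (s ∣▸ i)))))

-- The contribution of branch j to `rep u s`. It is computed below for u the root, u in branch j,
-- and u in another branch.
block : NodeSet δ (suc m) → Node δ (suc m) → Fin δ → List ℕ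
block s u j = map (dist u) (map (j ▸_) (elems (s ∣▸ j)))

rep-suc : (s : NodeSet δ (suc m)) (u : Node δ (suc m)) →
          rep u s ≡ map (dist u) (topElem s) ++ concat (tabulate (block s u))
rep-suc s u = begin
  map (dist u) (topElem s ++ concat (tabulate g))
    ≡⟨ map-++ (dist u) (topElem s) _ ⟩
  map (dist u) (topElem s) ++ map (dist u) (concat (tabulate g))
    ≡⟨ cong (map (dist u) (topElem s) ++_) (concat-map (tabulate g)) ⟨
  map (dist u) (topElem s) ++ concat (map (map (dist u)) (tabulate g))
    ≡⟨ cong (λ z → map (dist u) (topElem s) ++ concat z) (map-tabulate g (map (dist u))) ⟩
  map (dist u) (topElem s) ++ concat (tabulate (block s u)) ∎
  where
  open ≡-Reasoning
  g = λ i → map (i ▸_) (elems (s ∣▸ i))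

block-top : (s : NodeSet δ (suc m)) (j : Fin δ) → block s top j ≡ map suc (rep top (s ∣▸ j))
block-top s j = trans (sym (map-∘ (elems (s ∣▸ j)))) (map-∘ (elems (s ∣▸ j)))

block-same : (s : NodeSet δ (suc m)) (i : Fin δ) (u : Node δ m) →
             block s (i ▸ u) i ≡ rep u (s ∣▸ i)
block-same s i u = trans (sym (map-∘ (elems (s ∣▸ i)))) (map-cong (dist-same i u) (elems (s ∣▸ i)))

block-diff : (s : NodeSet δ (suc m)) {i j : Fin δ} → i ≢ j → (u : Node δ m) →
             block s (i ▸ u) j ≡ map (λ k → suc (depth u) + suc k) (rep top (s ∣▸ j))
block-diff s {j = j} i≢j u = trans (sym (map-∘ (elems (s ∣▸ j))))
  (trans (map-cong (dist-diff i≢j u) (elems (s ∣▸ j))) (map-∘ (elems (s ∣▸ j))))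

topElem-dist : (s : NodeSet δ m) (u v : Node δ m) → dist u top ≡ dist v top →
               map (dist u) (topElem s) ≡ map (dist v) (topElem s)
topElem-dist s u v eq with s top
... | true  = cong [_] eq
... | false = refl

module _ (s : NodeSet δ (suc m)) (i : Fin δ) {u v : Node δ m} (eq : depth u ≡ depth v) where

  private
    -- Every path out of branch i passes through `top`, so only the depth of its starting vertex
    -- matters.
    same-outside : ∀ j → j ≢ i → block s (i ▸ u) j ≡ block s (i ▸ v) j
    same-outside j j≢i = trans (block-diff s (j≢i ∘ sym) u)
      (trans (cong (λ d → map (λ k → suc d + suc k) _) eq) (sym (block-diff s (j≢i ∘ sym) v)))

    same-top : map (dist (i ▸ u)) (topElem s) ≡ map (dist (i ▸ v)) (topElem s)
    same-top = topElem-dist s (i ▸ u) (i ▸ v) (cong suc eq)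

  rep-branch⁺ : rep u (s ∣▸ i) ↭ rep v (s ∣▸ i) → rep (i ▸ u) s ↭ rep (i ▸ v) s
  rep-branch⁺ p rewrite rep-suc s (i ▸ u) | rep-suc s (i ▸ v) | same-top =
    ++⁺ˡ (map (dist (i ▸ v)) (topElem s)) (concat-tabulate-↭⁺ i same-outside
      (subst₂ _↭_ (sym (block-same s i u)) (sym (block-same s i v)) p))

  -- The contributions from `top` and the other branches agree and cancel, leaving the comparison
  -- inside branch i.
  rep-branch⁻ : rep (i ▸ u) s ↭ rep (i ▸ v) s → rep u (s ∣▸ i) ↭ rep v (s ∣▸ i)
  rep-branch⁻ p rewrite rep-suc s (i ▸ u) | rep-suc s (i ▸ v) | same-top =
    subst₂ _↭_ (block-same s i u) (block-same s i v) (concat-tabulate-↭⁻ i same-outside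
      (++-cancelˡ-↭ (map (dist (i ▸ v)) (topElem s)) p))

-- Resolving sets of the model

-- The branch lemmas compare vertices of equal depth, so `LevelResolving` is the notion that
-- restricts to branches and is rebuilt from them.
Resolving LevelResolving : NodeSet δ m → Set
Resolving s = ∀ u v → s u ≡ false → s v ≡ false → u ≢ v → ¬ (rep u s ↭ rep v s)
LevelResolving s =
  ∀ u v → s u ≡ false → s v ≡ false → depth u ≡ depth v → u ≢ v → ¬ (rep u s ↭ rep v s)

branch-resolving : (s : NodeSet δ (suc m)) → LevelResolving s → ∀ i → LevelResolving (s ∣▸ i)
branch-resolving s res i u v u∉ v∉ eq u≢v p =
  res (i ▸ u) (i ▸ v) u∉ v∉ (cong suc eq) (u≢v ∘ ▸-injectiveʳ) (rep-branch⁺ s i eq p)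

-- A chosen child is neither i nor j, hence at distance 2 from both, and `top` is at distance 1 from
-- both.
rep-children : (s : NodeSet δ 1) (i j : Fin δ) → s (i ▸ top) ≡ false → s (j ▸ top) ≡ false →
               rep (i ▸ top) s ≡ rep (j ▸ top) s
rep-children s i j i∉ j∉ = trans (rep-suc s (i ▸ top)) (trans
  (cong₂ _++_ (topElem-dist s (i ▸ top) (j ▸ top) refl) (cong concat (tabulate-cong same)))
  (sym (rep-suc s (j ▸ top))))
  where
  same : ∀ k → block s (i ▸ top) k ≡ block s (j ▸ top) k
  same k with s (k ▸ top) in k-eq
  ... | false = refl
  ... | true  = cong [_] (trans (dist-diff {m = 0} (i≢k i∉) top top)
                            (sym (dist-diff {m = 0} (i≢k j∉) top top)))
    where
    i≢k : ∀ {i} → s (i ▸ top) ≡ false → i ≢ k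
    i≢k i∉ refl = case trans (sym i∉) k-eq of λ ()

LeafIn : NodeSet δ m → Set
LeafIn {m = m} s = ∃[ w ] depth w ≡ m × s w ≡ true

-- Two sibling leaves have the same distances to all other vertices, so a
-- resolving set contains one of them.
leaf-in-resolving : (s : NodeSet (suc (suc δ)) (suc m)) → LevelResolving s → LeafIn s
leaf-in-resolving {m = zero} s res with s (zero ▸ top) ≟ᵇ true | s (suc zero ▸ top) ≟ᵇ true
... | yes 0∈ | _      = zero ▸ top , refl , 0∈
... | no _   | yes 1∈ = suc zero ▸ top , refl , 1∈
... | no 0∉  | no 1∉  = ⊥-elim (res (zero ▸ top) (suc zero ▸ top) (¬-not 0∉) (¬-not 1∉) refl (λ ())
        (↭-reflexive (rep-children s zero (suc zero) (¬-not 0∉) (¬-not 1∉))))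
leaf-in-resolving {m = suc m} s res with leaf-in-resolving (s ∣▸ zero) (branch-resolving s res zero)
... | w , leaf , w∈ = zero ▸ w , cong suc leaf , w∈

-- A branch of depth 0 contains no pair of sibling leaves; there the unchosen vertex of branch i
-- serves as the sibling. Deeper branches have such a pair of their own.
leaf-in-other-branch : (s : NodeSet (suc (suc δ)) (suc m)) → LevelResolving s →
  {i j : Fin (suc (suc δ))} → i ≢ j → {u : Node (suc (suc δ)) m} → s (i ▸ u) ≡ false → LeafIn (s ∣▸ j)
leaf-in-other-branch {m = zero} s res {i} {j} i≢j {top} i∉ with s (j ▸ top) ≟ᵇ true
... | yes j∈ = top , refl , j∈
... | no  j∉ = ⊥-elim (res (i ▸ top) (j ▸ top) i∉ (¬-not j∉) refl (i≢j ∘ ▸-injectiveˡ)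
        (↭-reflexive (rep-children s i j i∉ (¬-not j∉))))
leaf-in-other-branch {m = suc m} s res {j = j} i≢j i∉ =
  leaf-in-resolving (s ∣▸ j) (branch-resolving s res j)

-- A chosen leaf outside the branch of u is reached through `top`, which costs `depth u` up and
-- `suc m` down.
eccentricity-attained : (s : NodeSet (suc (suc δ)) (suc m)) → LevelResolving s →
                        ∀ u → s u ≡ false → depth u + suc m ∈ rep u s
eccentricity-attained s res top u∉ with leaf-in-resolving s res
... | w , leaf , w∈ = subst (_∈ rep top s) leaf (∈-map⁺ depth (∈-elems⁺ s w w∈))
eccentricity-attained {δ = δ} {m} s res (i ▸ u) u∉ = via (other i)
  where
  other : (i : Fin (suc (suc δ))) → ∃[ j ] i ≢ j
  other zero    = suc zero , λ ()
  other (suc i) = zero , λ ()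
  via : ∃[ j ] i ≢ j → suc (depth u) + suc m ∈ rep (i ▸ u) s
  via (j , i≢j) with leaf-in-other-branch s res i≢j {u} u∉
  ... | w , leaf , w∈ = subst (_∈ rep (i ▸ u) s)
    (trans (dist-diff i≢j u w) (cong (λ k → suc (depth u) + suc k) leaf))
    (∈-map⁺ (dist (i ▸ u)) (∈-elems⁺ s (j ▸ w) w∈))

-- The deeper vertex v has a chosen vertex at distance `depth v + suc m`, whereas no vertex is
-- farther than `depth u + suc m` from u.
deeper-differs : (s : NodeSet (suc (suc δ)) (suc m)) → LevelResolving s →
                 ∀ u v → s v ≡ false → depth u < depth v → ¬ (rep u s ↭ rep v s)
deeper-differs {m = m} s res u v v∉ u<v p
  with ∈-map⁻ (dist u) (∈-resp-↭ (↭-sym p) (eccentricity-attained s res v v∉))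
... | w , _ , eq =
  <⇒≱ u<v (+-cancelʳ-≤ (suc m) _ _ (subst (_≤ depth u + suc m) (sym eq) (dist≤depth+m u w)))

levelResolving⇒resolving : (s : NodeSet (suc (suc δ)) (suc m)) → LevelResolving s → Resolving s
levelResolving⇒resolving s res u v u∉ v∉ u≢v p with <-cmp (depth u) (depth v)
... | tri< u<v _ _ = deeper-differs s res u v v∉ u<v p
... | tri≈ _ eq _  = res u v u∉ v∉ eq u≢v p
... | tri> _ _ v<u = deeper-differs s res v u u∉ v<u (↭-sym p)

resolving⇒levelResolving : (s : NodeSet δ m) → Resolving s → LevelResolving s
resolving⇒levelResolving s res u v u∉ v∉ _ = res u v u∉ v∉

-- Assembling a tree from its branches

-- Leaving the root out makes the size exactly the sum over the branches; the root is alone on its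
-- level and so needs no separation there.
graft : (Fin δ → NodeSet δ m) → NodeSet δ (suc m)
graft t top     = false
graft t (i ▸ u) = t i u

size-graft : (t : Fin δ → NodeSet δ m) → size (graft t) ≡ sum (λ i → size (t i))
size-graft t = size-suc (graft t)

leaves-graft : (t : Fin δ → NodeSet δ m) → leaves (graft t) ≡ sum (λ i → leaves (t i))
leaves-graft {m = m} t = trans (cong _⟦ suc m ⟧ (rep-suc (graft t) top))
  (trans (⟦⟧-concat-tabulate (block (graft t) top) (suc m))
  (sum-cong-≗ λ j → trans (cong _⟦ suc m ⟧ (block-top (graft t) j))
                          (⟦⟧-map suc-injective (rep top (t j)) m)))

-- The farthest elements, seen from branch i, are the leaves of the other branches.
farthest-graft : (t : Fin δ → NodeSet δ m) (i : Fin δ) (u : Node δ m) →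
  leaves (t i) + rep (i ▸ u) (graft t) ⟦ suc (depth u) + suc m ⟧ ≡ sum (λ j → leaves (t j))
farthest-graft {δ = suc δ} {m} t i u = begin
  leaves (t i) + rep (i ▸ u) (graft t) ⟦ k ⟧
    ≡⟨ cong (λ z → leaves (t i) + z ⟦ k ⟧) (rep-suc (graft t) (i ▸ u)) ⟩
  leaves (t i) + concat (tabulate b) ⟦ k ⟧
    ≡⟨ cong (leaves (t i) +_) (⟦⟧-concat-tabulate b k) ⟩
  leaves (t i) + sum (λ j → b j ⟦ k ⟧)
    ≡⟨ cong (leaves (t i) +_) (sum-remove {i = i} (λ j → b j ⟦ k ⟧)) ⟩
  leaves (t i) + (b i ⟦ k ⟧ + sum (λ j → b (punchIn i j) ⟦ k ⟧))
    ≡⟨ cong₂ (λ x y → leaves (t i) + (x + y)) none-own (sum-cong-≗ λ j → other (punchInᵢ≢i i j)) ⟩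
  leaves (t i) + sum (λ j → leaves (t (punchIn i j)))
    ≡⟨ sum-remove {i = i} (λ j → leaves (t j)) ⟨
  sum (λ j → leaves (t j)) ∎
  where
  open ≡-Reasoning
  -- The distance from `i ▸ u` to a leaf of another branch; distances inside branch i are at most
  -- `depth u + m`.
  k = suc (depth u) + suc m
  b = block (graft t) (i ▸ u)
  none-own : b i ⟦ k ⟧ ≡ 0
  none-own = trans (cong _⟦ k ⟧ (block-same (graft t) i u)) (⟦⟧-bounded (Allₚ.map⁺
    (All.universal (λ v → s≤s (≤-trans (dist≤depth+m u v) (+-monoʳ-≤ (depth u) (n≤1+n m))))
      (elems (t i)))))
  other : ∀ {j} → j ≢ i → b j ⟦ k ⟧ ≡ leaves (t j)
  other {j} j≢i = trans (cong _⟦ k ⟧ (block-diff (graft t) (j≢i ∘ sym) u))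
    (⟦⟧-map (suc-injective ∘ +-cancelˡ-≡ (suc (depth u)) _ _) (rep top (t j)) m)

graft-resolving : (t : Fin δ → NodeSet δ m) → (∀ i → LevelResolving (t i)) →
                  (∀ i j → i ≢ j → leaves (t i) ≢ leaves (t j)) → LevelResolving (graft t)
graft-resolving t res distinct top     top     _ _ _ u≢v _ = u≢v refl
graft-resolving {m = m} t res distinct (i ▸ u) (j ▸ v) u∉ v∉ eq u≢v p with i ≟ᶠ j
... | yes refl = res i u v u∉ v∉ (suc-injective eq) (u≢v ∘ cong (i ▸_))
                   (rep-branch⁻ (graft t) i (suc-injective eq) p)
-- On both sides, own leaves plus farthest elements make up the same total, so equal farthest counts
-- force equal leaf counts of branches i and j.
... | no i≢j = distinct i j i≢j (+-cancelʳ-≡ (rep (j ▸ v) (graft t) ⟦ suc (depth v) + suc m ⟧) _ _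
        (trans (cong (leaves (t i) +_) (sym same-count))
        (trans (farthest-graft t i u) (sym (farthest-graft t j v)))))
  where
  same-count : rep (i ▸ u) (graft t) ⟦ suc (depth u) + suc m ⟧ ≡
               rep (j ▸ v) (graft t) ⟦ suc (depth v) + suc m ⟧
  same-count = trans (⟦⟧-↭ _ p) (cong (λ d → rep (j ▸ v) (graft t) ⟦ d + suc m ⟧) eq)

-- The invariant of the induction on the depth: D is the minimum size of a level-resolving set, and
-- enough minimum sets with different leaf counts exist to build the next level.
record Distinguished (δ m D : ℕ) : Set where
  field
    least    : (s : NodeSet δ m) → LevelResolving s → D ≤ size s
    base     : Fin (suc δ) → NodeSet δ m
    resolves : ∀ i → LevelResolving (base i)
    size≡    : ∀ i → size (base i) ≡ D
    distinct : ∀ i j → i ≢ j → leaves (base i) ≢ leaves (base j)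

distinguished-suc : Distinguished δ m D → Distinguished δ (suc m) (δ * D)
distinguished-suc {δ} {m} {D} dist = record
  { least    = λ s res → subst (δ * D ≤_) (sym (size-suc s))
                 -- The root itself may belong to `s`; its contribution is dropped from the lower
                 -- bound.
                 (≤-trans (sum-lower λ i → least (s ∣▸ i) (branch-resolving s res i)) (m≤n+m _ _))
  ; base     = λ k → graft (omit k)
  ; resolves = λ k → graft-resolving (omit k) (λ i → resolves (punchIn k i))
                 (λ i j i≢j → distinct _ _ (i≢j ∘ punchIn-injective k i j))
  ; size≡    = λ k → trans (size-graft (omit k)) (sum-const λ i → size≡ (punchIn k i))
  -- The k-th graft has the total leaf count less that of `base k`, so equal counts for two grafts
  -- give equal counts for the omitted sets.
  ; distinct = λ k l k≢l eq → distinct k l k≢l (+-cancelʳ-≡ (leaves (graft (omit l))) _ _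
                 (trans (cong (leaves (base k) +_) (sym eq)) (trans (total k) (sym (total l)))))
  }
  where
  open Distinguished dist
  omit : Fin (suc δ) → Fin δ → NodeSet δ m
  omit k i = base (punchIn k i)
  total : ∀ k → leaves (base k) + leaves (graft (omit k)) ≡ sum (λ i → leaves (base i))
  total k = trans (cong (leaves (base k) +_) (leaves-graft (omit k)))
                  (sym (sum-remove {i = k} (λ i → leaves (base i))))

distinguished-+ : ∀ k → Distinguished δ m D → Distinguished δ (k + m) (δ ^ k * D)
distinguished-+         zero    dist = subst (Distinguished _ _) (sym (*-identityˡ _)) dist
distinguished-+ {δ = δ} (suc k) dist =
  subst (Distinguished _ _) (sym (*-assoc δ (δ ^ k) _)) (distinguished-suc (distinguished-+ k dist))

-- Lists without repetition

unique-↭ : Unique xs → Unique ys → (∀ {z} → z ∈ xs → z ∈ ys) → (∀ {z} → z ∈ ys → z ∈ xs) → xs ↭ ys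
unique-↭ ux uy to from = ∼bag⇒↭ (unique∧set⇒bag ux uy (mk⇔ to from))

unique-reverse : Unique xs → Unique (reverse xs)
unique-reverse {xs = xs} = PermSetoid.Unique-resp-↭ (setoid _) (↭⇒↭ₛ (↭-sym (↭-reverse xs)))

lookup-unique-injective : Unique xs → ∀ i j → lookup xs i ≡ lookup xs j → i ≡ j
lookup-unique-injective (_   ∷ _) zero    zero    _  = refl
lookup-unique-injective (x∉  ∷ _) zero    (suc j) eq = ⊥-elim (All.lookup x∉ (∈-lookup j) eq)
lookup-unique-injective (x∉  ∷ _) (suc i) zero    eq = ⊥-elim (All.lookup x∉ (∈-lookup i) (sym eq))
lookup-unique-injective (_   ∷ u) (suc i) (suc j) eq = cong suc (lookup-unique-injective u i j eq)

unique-length≤ : {xs : List (Fin n)} → Unique xs → length xs ≤ n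
unique-length≤ u = injective⇒≤ λ {i} {j} → lookup-unique-injective u i j

unique-∷ : ∀ {x : A} {xs} → x ∉ xs → Unique xs → Unique (x ∷ xs)
unique-∷ x∉ u = Allₚ.¬Any⇒All¬ _ x∉ ∷ u

-- Walks

-- An inductive form of the conditions in `IsPath`, kept apart from distinctness so that walks can
-- be joined and reversed by recursion.
data Walk {A : Set} (R : A → A → Set) : A → A → List A → Set where
  stop : ∀ {u} → Walk R u u [ u ]
  _∷_  : ∀ {u v w xs} → R u v → Walk R v w xs → Walk R u w (u ∷ xs)

walk-append : Walk R u v xs → R v w → ∀ {z ys} → Walk R w z ys → Walk R u z (xs ++ ys)
walk-append stop    r q = r ∷ q
walk-append (s ∷ p) r q = s ∷ walk-append p r q

walk-map : {S : B → B → Set} {f : A → B} → (∀ {x y} → R x y → S (f x) (f y)) →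
           Walk R u v xs → Walk S (f u) (f v) (map f xs)
walk-map h stop    = stop
walk-map h (r ∷ p) = h r ∷ walk-map h p

walk-reverse : (∀ {x y} → R x y → R y x) → Walk R u v xs → Walk R v u (reverse xs)
walk-reverse R-sym stop = stop
walk-reverse {R = R} R-sym (_∷_ {u} {xs = xs} r p) =
  subst (Walk R _ _) (sym (unfold-reverse u xs)) (walk-append (walk-reverse R-sym p) (R-sym r) stop)

walk-start∈ : Walk R u v xs → u ∈ xs
walk-start∈ stop    = here refl
walk-start∈ (_ ∷ _) = here refl

walk-end∈ : Walk R u v xs → v ∈ xs
walk-end∈ stop    = here refl
walk-end∈ (_ ∷ p) = there (walk-end∈ p)

walk-prefix : Walk R u v xs → Unique xs → w ∈ xs →
              ∃[ ys ] ∃[ zs ] Walk R u w ys × Unique ys × xs ≡ ys ++ zs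
walk-prefix {xs = x ∷ xs} stop    _        (here refl) = _ , xs , stop , [] ∷ [] , refl
walk-prefix {xs = x ∷ xs} (_ ∷ _) _        (here refl) = _ , xs , stop , [] ∷ [] , refl
walk-prefix {xs = x ∷ _}  (r ∷ p) (x∉ ∷ u) (there w∈) with walk-prefix p u w∈
... | ys , zs , q , uq , refl = x ∷ ys , zs , r ∷ q , Allₚ.++⁻ˡ ys x∉ ∷ uq , refl

module _ {n : ℕ} {_~_ : Fin n → Fin n → Set} where
  open Paths _~_

  walk⇒isPath : ∀ {u v xs} → Walk _~_ u v xs → Unique xs → IsPath u v xs
  walk⇒isPath p = isPath (starts p) (ends p) (adjacent p)
    where
    starts : ∀ {u v xs} → Walk _~_ u v xs → head xs ≡ just u
    starts stop    = refl
    starts (_ ∷ _) = refl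
    ends : ∀ {u v xs} → Walk _~_ u v xs → last xs ≡ just v
    ends stop          = refl
    ends (_ ∷ stop)    = refl
    ends (_ ∷ (r ∷ p)) = ends (r ∷ p)
    adjacent : ∀ {u v xs} → Walk _~_ u v xs → Linked _~_ xs
    adjacent stop          = [-]
    adjacent (r ∷ stop)    = r ∷ [-]
    adjacent (r ∷ (s ∷ p)) = r ∷ adjacent (s ∷ p)

  isPath⇒walk : ∀ {u v xs} → IsPath u v xs → Walk _~_ u v xs
  isPath⇒walk (isPath s e a _) = go s e a
    where
    go : ∀ {u v xs} → head xs ≡ just u → last xs ≡ just v → Linked _~_ xs → Walk _~_ u v xs
    go refl refl [-]     = stop
    go refl e    (r ∷ a) = r ∷ go refl e a

-- Geodesics of the model

data Adj {δ : ℕ} : Node δ m → Node δ m → Set where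
  down : (i : Fin δ) → Adj {m = suc m} top (i ▸ top)
  up   : (i : Fin δ) → Adj {m = suc m} (i ▸ top) top
  into : (i : Fin δ) {u v : Node δ m} → Adj u v → Adj (i ▸ u) (i ▸ v)

-- Its image in a full tree is a shortest path, because the path between two vertices there is
-- unique.
Geodesic : Node δ m → Node δ m → Set
Geodesic u v = ∃[ xs ] Walk Adj u v xs × Unique xs × length xs ≡ suc (dist u v)

top∉branch : (i : Fin δ) {xs : List (Node δ m)} → top ∉ map (i ▸_) xs
top∉branch i t∈ with ∈-map⁻ (i ▸_) t∈
... | _ , _ , ()

descent : (v : Node δ m) → Geodesic top v
descent top     = [ top ] , stop , [] ∷ [] , refl
descent (i ▸ v) with descent v
... | xs , p , u , len = top ∷ map (i ▸_) xs , down i ∷ walk-map (into i) p ,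
  unique-∷ (top∉branch i) (Uniqueₚ.map⁺ ▸-injectiveʳ u) , cong suc (trans (length-map _ xs) len)

ascent : (u : Node δ m) → ∃[ xs ] Walk Adj u top xs × Unique xs × length xs ≡ suc (depth u)
ascent top     = [ top ] , stop , [] ∷ [] , refl
ascent (i ▸ u) with ascent u
... | xs , p , uq , len = map (i ▸_) xs ∷ʳ top , walk-append (walk-map (into i) p) (up i) stop ,
  Uniqueₚ.++⁺ (Uniqueₚ.map⁺ ▸-injectiveʳ uq) ([] ∷ []) (λ { (t∈ , here refl) → top∉branch i t∈ }) ,
  trans (length-++ (map (i ▸_) xs)) (trans (+-comm _ 1) (cong suc (trans (length-map _ xs) len)))

geodesic : (u v : Node δ m) → Geodesic u v
geodesic top     v       = descent v
geodesic (i ▸ u) top     = ascent (i ▸ u)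
geodesic (i ▸ u) (j ▸ v) with i ≟ᶠ j
... | yes refl with geodesic u v
...   | xs , p , uq , len = map (i ▸_) xs , walk-map (into i) p , Uniqueₚ.map⁺ ▸-injectiveʳ uq ,
        trans (length-map _ xs) len
geodesic {m = suc m} (i ▸ u) (j ▸ v) | no i≢j with ascent u | descent v
... | xs , p , uxs , lenᵖ | ys , q , uq , len =
  -- Up through branch i to `top`, then down through branch j.
  map (i ▸_) xs ++ top ∷ map (j ▸_) ys ,
  walk-append (walk-map (into i) p) (up i) (down j ∷ walk-map (into j) q) ,
  Uniqueₚ.++⁺ (Uniqueₚ.map⁺ ▸-injectiveʳ uxs)
    (unique-∷ (top∉branch j) (Uniqueₚ.map⁺ ▸-injectiveʳ uq)) disjoint ,
  trans (length-++ (map (i ▸_) xs)) (add-lengths (trans (length-map _ xs) lenᵖ)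
    (cong suc (trans (length-map _ ys) len)))
  where
  add-lengths : ∀ {a b c d} → a ≡ suc c → b ≡ suc d → a + b ≡ suc (suc (c + d))
  add-lengths {c = c} {d} refl refl = cong suc (+-suc c d)
  disjoint : Disjoint (map (i ▸_) xs) (top ∷ map (j ▸_) ys)
  disjoint (z∈ , here refl) = top∉branch i z∈
  disjoint (z∈ , there z∈′) with ∈-map⁻ (i ▸_) z∈ | ∈-map⁻ (j ▸_) z∈′
  ... | _ , _ , refl | _ , _ , eq = i≢j (▸-injectiveˡ eq)

-- The model is isometric to every full tree

lookupBy : (xs : List A) → length xs ≡ n → Fin n → A
lookupBy xs refl = lookup xs

lookupBy-∈ : (xs : List A) (eq : length xs ≡ n) (i : Fin n) → lookupBy xs eq i ∈ xs
lookupBy-∈ xs refl = ∈-lookup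

lookupBy-injective : Unique xs → (eq : length xs ≡ n) → ∀ i j →
                     lookupBy xs eq i ≡ lookupBy xs eq j → i ≡ j
lookupBy-injective u refl = lookup-unique-injective u

lookupBy-surjective : ∀ {x : A} {xs} → x ∈ xs → (eq : length xs ≡ n) →
                      ∃[ i ] lookupBy xs eq i ≡ x
lookupBy-surjective x∈ refl = index x∈ , sym (lookup-index x∈)

-- The common tail fixes the position counted from the end. For root paths this recovers the child
-- through which a path continues.
++∷-injective : ∀ (xs ys : List A) {x y zs} → xs ++ x ∷ zs ≡ ys ++ y ∷ zs → x ≡ y
++∷-injective xs ys {x} {y} {zs} eq = ∷ʳ-injectiveʳ xs ys (++-cancelʳ zs (xs ∷ʳ x) (ys ∷ʳ y)
  (trans (++-assoc xs [ x ] zs) (trans eq (sym (++-assoc ys [ y ] zs)))))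

¬self-++-∷ : ∀ (ys : List A) {y xs} → xs ≢ ys ++ y ∷ xs
¬self-++-∷ ys {y} {xs} eq = m+1+n≢n (length ys)
  (sym (trans (cong length eq) (length-++ ys)))

record Isometry (δ ℓ : ℕ) (T : RootedGraph) : Set where
  open RootedGraph T
  field
    f     : Node δ ℓ → V
    g     : V → Node δ ℓ
    f∘g   : ∀ v → f (g v) ≡ v
    g∘f   : ∀ u → g (f u) ≡ u
    f-top : f top ≡ root
    d-f   : ∀ u v → d (f u) (f v) ≡ dist u v

  f-injective : ∀ {u v} → f u ≡ f v → u ≡ v
  f-injective {u} {v} eq = trans (sym (g∘f u)) (trans (cong g eq) (g∘f v))

module _ {δ ℓ : ℕ} {T : RootedGraph} (full : IsFullTree δ ℓ T) where
  open RootedGraph T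
  open IsFullTree full
  open DecMembership (_≟ᶠ_ {order}) using (_∈?_)

  -- By uniqueness, the shortest path that witnesses `d u v` is the given one.
  path-length : ∀ {u v xs} → Walk _~_ u v xs → Unique xs → length xs ≡ suc (d u v)
  path-length {u} {v} p uq with d-minimum u v
  ... | _ , (_ , q , len) , _ = trans (cong length (isTree (walk⇒isPath p uq) q)) len

  -- Directed towards the root, so that passing to a child prepends one vertex.
  RootPath : V → List V → Set
  RootPath v xs = Walk _~_ v root xs × Unique xs

  rootPath-unique : ∀ {v xs ys} → RootPath v xs → RootPath v ys → xs ≡ ys
  rootPath-unique (p , u) (q , u′) = isTree (walk⇒isPath p u) (walk⇒isPath q u′)

  rootPath-length : ∀ {v xs} → RootPath v xs → length xs ≡ suc (d root v)
  rootPath-length {xs = xs} (p , u) =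
    trans (sym (length-reverse xs)) (path-length (walk-reverse symmetric p) (unique-reverse u))

  extend : ∀ {v y xs} → RootPath v xs → v ~ y → y ∉ xs → RootPath y (y ∷ xs)
  extend (p , u) v~y y∉ = symmetric v~y ∷ p , unique-∷ y∉ u

  -- Otherwise there would be two paths from v to y.
  neighbour-on-path : ∀ {v w p y xs} → Walk _~_ v w (v ∷ p ∷ xs) → Unique (v ∷ p ∷ xs) →
                      v ~ y → y ∈ v ∷ p ∷ xs → y ≡ p
  neighbour-on-path {v} {y = y} q u v~y y∈ with walk-prefix q u y∈
  ... | ys , zs , q′ , u′ , eq
    with isTree (walk⇒isPath q′ u′) (walk⇒isPath (v~y ∷ stop) (unique-∷ v∉ ([] ∷ [])))
    where
    v∉ : v ∉ [ y ]
    v∉ (here v≡y) = loopless v≡y v~y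
  ... | refl with eq
  ... | refl = refl

  neighbours : V → List V
  neighbours v = filter (v ~?_) (allFin order)

  neighbours-unique : ∀ v → Unique (neighbours v)
  neighbours-unique v = Uniqueₚ.filter⁺ (v ~?_) (Uniqueₚ.allFin⁺ order)

  ∈-neighbours⁺ : ∀ {v y} → v ~ y → y ∈ neighbours v
  ∈-neighbours⁺ {v} {y} = ∈-filter⁺ (v ~?_) (∈-allFin y)

  ∈-neighbours⁻ : ∀ {v y} → y ∈ neighbours v → v ~ y
  ∈-neighbours⁻ {v} y∈ = proj₂ (∈-filter⁻ (v ~?_) {xs = allFin order} y∈)

  off? : (xs : List V) (y : V) → _
  off? xs y = ¬? (y ∈? xs)

  -- Here `xs` is meant to be the root path of v, on which the parent is the only neighbour of v.
  children : V → List V → List V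
  children v xs = filter (off? xs) (neighbours v)

  children-unique : ∀ v xs → Unique (children v xs)
  children-unique v xs = Uniqueₚ.filter⁺ (off? xs) (neighbours-unique v)

  ∈-children⁺ : ∀ {v y xs} → v ~ y → y ∉ xs → y ∈ children v xs
  ∈-children⁺ {xs = xs} v~y = ∈-filter⁺ (off? xs) (∈-neighbours⁺ v~y)

  ∈-children⁻ : ∀ {v y xs} → y ∈ children v xs → v ~ y × y ∉ xs
  ∈-children⁻ {v} {xs = xs} y∈ with ∈-filter⁻ (off? xs) {xs = neighbours v} y∈
  ... | y∈N , y∉ = ∈-neighbours⁻ y∈N , y∉

  children-root-length : ∀ {xs} → RootPath root xs → length (children root xs) ≡ δ
  children-root-length (stop , _) = trans (cong length (filter-all (off? [ root ])
    (All.tabulate λ {y} y∈ → λ { (here y≡) → loopless (sym y≡) (∈-neighbours⁻ y∈) }))) root-degree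
  children-root-length (_ ∷ p , r∉ ∷ _) = ⊥-elim (Allₚ.All¬⇒¬Any r∉ (walk-end∈ p))

  degree-nonroot : ∀ {v xs} → v ≢ root → RootPath v xs → degree v ≡ suc (length (children v xs))
  degree-nonroot v≢r (stop , _) = ⊥-elim (v≢r refl)
  degree-nonroot {v} v≢r (_∷_ {v = p} r q , u) = ↭-length (unique-↭ (neighbours-unique v)
      (unique-∷ p∉ (children-unique v _)) to from)
    where
    p∈ = there (walk-start∈ q)
    p∉ : p ∉ children v _
    p∉ p∈c = proj₂ (∈-children⁻ {xs = _ ∷ _} p∈c) p∈
    to : ∀ {y} → y ∈ neighbours v → y ∈ p ∷ children v _
    to {y} y∈ with y ∈? (v ∷ _)
    ... | no y∉  = there (∈-children⁺ (∈-neighbours⁻ y∈) y∉)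
    ... | yes y∈p = here (parent r q u (∈-neighbours⁻ y∈) y∈p)
      where
      -- The case split on the walk exposes p as the second vertex of the path, as
      -- `neighbour-on-path` expects.
      parent : ∀ {p xs} → v ~ p → Walk _~_ p root xs → Unique (v ∷ xs) → v ~ y → y ∈ v ∷ xs → y ≡ p
      parent r stop    = neighbour-on-path (r ∷ stop)
      parent r (s ∷ q) = neighbour-on-path (r ∷ s ∷ q)
    from : ∀ {y} → y ∈ p ∷ children v _ → y ∈ neighbours v
    from (here refl) = ∈-neighbours⁺ r
    from (there y∈)  = ∈-neighbours⁺ (proj₁ (∈-children⁻ {xs = _ ∷ _} y∈))

  -- A root path has one vertex more than the depth of v, so v is not on the leaf level. Unless v is
  -- the root, its degree is then `suc δ`, and one neighbour is the parent.
  children-length : ∀ {v xs} → RootPath v xs → length xs ≢ suc ℓ → length (children v xs) ≡ δ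
  children-length {v} p shallow with v ≟ᶠ root
  ... | yes refl = children-root-length p
  ... | no v≢r with inner v v≢r
  ...   | inj₁ leaf = ⊥-elim (shallow (trans (rootPath-length p) (cong suc (leaf-depth v leaf))))
  ...   | inj₂ deg  = suc-injective (trans (sym (degree-nonroot v≢r p)) deg)

  0<δ : 0 < δ
  0<δ with leaf-exists
  ... | v , v≢r , _ with connected root v
  ...   | _ , _ , p , _ with isPath⇒walk p
  ...     | stop  = ⊥-elim (v≢r refl)
  ...     | r ∷ _ = subst (0 <_) root-degree (∈-length (∈-neighbours⁺ r))

  module _ {v : V} {xs : List V} (p : RootPath v xs) (shallow : length xs ≢ suc ℓ) where

    child : Fin δ → V
    child = lookupBy (children v xs) (children-length p shallow)

    private
      child∈ : ∀ i → v ~ child i × child i ∉ xs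
      child∈ i = ∈-children⁻ {xs = xs} (lookupBy-∈ _ (children-length p shallow) i)

    child-adjacent : ∀ i → v ~ child i
    child-adjacent i = proj₁ (child∈ i)

    child-path : ∀ i → RootPath (child i) (child i ∷ xs)
    child-path i = extend p (child-adjacent i) (proj₂ (child∈ i))

    child-injective : ∀ i j → child i ≡ child j → i ≡ j
    child-injective = lookupBy-injective (children-unique v xs) (children-length p shallow)

    child-surjective : ∀ {y} → v ~ y → y ∉ xs → ∃[ i ] child i ≡ y
    child-surjective v~y y∉ = lookupBy-surjective (∈-children⁺ v~y y∉) (children-length p shallow)

  -- A vertex below level ℓ is not a leaf, hence has a child; descending further
  -- gives arbitrarily long paths.
  not-too-deep : ∀ k {v xs} → RootPath v xs → suc ℓ < length xs → order < k + length xs → ⊥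
  not-too-deep zero    (p , u) deep long = <⇒≱ long (unique-length≤ u)
  not-too-deep (suc k) {v} {xs} p deep long =
    not-too-deep k (child-path p shallow i) (m≤n⇒m≤1+n deep)
      (subst (order <_) (sym (+-suc k (length xs))) long)
    where
    shallow : length xs ≢ suc ℓ
    shallow eq = <-irrefl (sym eq) deep
    i = fromℕ< 0<δ

  -- Such a y would lie below level ℓ. Descending `suc order` further steps exceeds the number of
  -- vertices.
  bottom : ∀ {v y xs} → RootPath v xs → length xs ≡ suc ℓ → v ~ y → y ∉ xs → ⊥
  bottom p len v~y y∉ = not-too-deep (suc order) (extend p v~y y∉) (s≤s (≤-reflexive (sym len)))
    (s≤s (m≤m+n order _))

  -- The embedding of words along root paths

  private
    shallow : ∀ {k} m → k + suc m ≡ suc ℓ → k ≢ suc ℓ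
    shallow m e refl = m+1+n≢m _ e

    next : ∀ {k} m → k + suc m ≡ suc ℓ → suc k + m ≡ suc ℓ
    next {k} m e = trans (sym (+-suc k m)) e

  -- The word is followed from v downwards, its letters numbering the children. The equation says
  -- that m levels remain below v, so v has children whenever m is positive.
  embed : ∀ m {v xs} → RootPath v xs → length xs + m ≡ suc ℓ → Node δ m → V
  embed m       {v} p e top     = v
  embed (suc m) {v} p e (i ▸ u) = embed m (child-path p (shallow m e) i) (next m e) u

  embed-path : ∀ m {v xs} (p : RootPath v xs) (e : length xs + m ≡ suc ℓ) u →
               ∃[ ys ] RootPath (embed m p e u) (ys ++ xs)
  embed-path m       p e top     = [] , p
  embed-path (suc m) {xs = xs} p e (i ▸ u)
    with embed-path m (child-path p (shallow m e) i) (next m e) u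
  ... | ys , q = ys ∷ʳ c , subst (RootPath _) (sym (++-assoc ys [ c ] xs)) q
    where c = child p (shallow m e) i

  -- Equal images have equal root paths. If just one word is empty, `xs` would be a proper suffix of
  -- itself; otherwise the entry just before the suffix `xs` determines the first letter.
  embed-injective : ∀ m {v xs} (p : RootPath v xs) (e : length xs + m ≡ suc ℓ) u u′ →
                    embed m p e u ≡ embed m p e u′ → u ≡ u′
  embed-injective m       p e top     top      eq = refl
  embed-injective (suc m) p e top     (i ▸ u′) eq
    with embed-path m (child-path p (shallow m e) i) (next m e) u′
  ... | ys , q = ⊥-elim (¬self-++-∷ ys (rootPath-unique (subst (λ x → RootPath x _) eq p) q))
  embed-injective (suc m) p e (i ▸ u) top      eq
    with embed-path m (child-path p (shallow m e) i) (next m e) u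
  ... | ys , q = ⊥-elim (¬self-++-∷ ys (rootPath-unique (subst (λ x → RootPath x _) (sym eq) p) q))
  embed-injective (suc m) p e (i ▸ u) (j ▸ u′) eq
    with embed-path m (child-path p (shallow m e) i) (next m e) u
       | embed-path m (child-path p (shallow m e) j) (next m e) u′
  ... | ys , q | ys′ , q′
    with child-injective p (shallow m e) i j
           (++∷-injective ys ys′ (rootPath-unique (subst (λ x → RootPath x _) eq q) q′))
  ... | refl = cong (i ▸_) (embed-injective m _ _ u u′ eq)

  -- A path that starts at v and otherwise avoids the root path `xs` can only step to children. The
  -- clause `z ≢ v` exempts v, which lies on `xs` itself.
  embed-surjective : ∀ m {v xs} (p : RootPath v xs) (e : length xs + m ≡ suc ℓ) {x ws} →
                     Walk _~_ v x ws → Unique ws → (∀ {z} → z ∈ ws → z ≢ v → z ∉ xs) →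
                     ∃[ u ] embed m p e u ≡ x
  embed-surjective m p e stop _ _ = top , refl
  embed-surjective m {v} {xs} p e (_∷_ {v = y} v~y q) (v∉ ∷ uq) off = descend m e
    where
    y∈ = walk-start∈ q
    off-v : ∀ {z} → z ∈ _ → z ∉ xs
    off-v z∈ = off (there z∈) λ z≡v → All.lookup v∉ z∈ (sym z≡v)
    descend : ∀ m (e : length xs + m ≡ suc ℓ) → ∃[ u ] embed m p e u ≡ _
    descend zero    e = ⊥-elim (bottom p (trans (sym (+-identityʳ _)) e) v~y (off-v y∈))
    descend (suc m) e with child-surjective p (shallow m e) v~y (off-v y∈)
    ... | i , refl with embed-surjective m (child-path p (shallow m e) i) (next m e) q uq
                          (λ { z∈ z≢ (here z≡) → z≢ z≡ ; z∈ z≢ (there z∈xs) → off-v z∈ z∈xs })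
    ...   | u , eq = i ▸ u , eq

  embed-adjacent : ∀ m {v xs} (p : RootPath v xs) (e : length xs + m ≡ suc ℓ) {u u′} →
                   Adj u u′ → embed m p e u ~ embed m p e u′
  embed-adjacent (suc m) p e (down i)   = child-adjacent p (shallow m e) i
  embed-adjacent (suc m) p e (up i)     = symmetric (child-adjacent p (shallow m e) i)
  embed-adjacent (suc m) p e (into i a) = embed-adjacent m _ _ a

  isometry : Isometry δ ℓ T
  isometry = record
    { f     = f
    ; g     = λ v → proj₁ (onto v)
    ; f∘g   = λ v → proj₂ (onto v)
    ; g∘f   = λ u → injective (proj₂ (onto (f u)))
    ; f-top = refl
    ; d-f   = d-f
    }
    where
    root-path : RootPath root [ root ]
    root-path = stop , [] ∷ []
    f : Node δ ℓ → V
    f = embed ℓ root-path refl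
    injective : ∀ {u v} → f u ≡ f v → u ≡ v
    injective = embed-injective ℓ root-path refl _ _
    onto : ∀ v → ∃[ u ] f u ≡ v
    onto v with connected root v
    ... | _ , _ , p , _ = embed-surjective ℓ root-path refl (isPath⇒walk p) (IsPath.distinct p)
                            λ { _ z≢r (here z≡r) → z≢r z≡r }
    d-f : ∀ u v → d (f u) (f v) ≡ dist u v
    d-f u v with geodesic u v
    ... | xs , p , uq , len = suc-injective (trans
      (sym (path-length (walk-map (embed-adjacent ℓ root-path refl) p) (Uniqueₚ.map⁺ injective uq)))
      (trans (length-map f xs) len))

-- Resolving sets of full trees

length-filter-tabulate : {P : A → Set} (P? : U.Decidable P) (f : Fin n → A) (S : Subset n) →
                         (∀ i → does (P? (f i)) ≡ lookupᵛ S i) →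
                         length (filter P? (tabulate f)) ≡ ∣ S ∣
length-filter-tabulate P? f []      eq = refl
length-filter-tabulate P? f (b ∷ S) eq with does (P? (f zero)) | eq zero
... | true  | refl = cong suc (length-filter-tabulate P? (f ∘ suc) S (eq ∘ suc))
... | false | refl = length-filter-tabulate P? (f ∘ suc) S (eq ∘ suc)

∈ˢ?-lookup : (S : Subset n) (i : Fin n) → does (i ∈ˢ? S) ≡ lookupᵛ S i
∈ˢ?-lookup (true  ∷ S) zero    = refl
∈ˢ?-lookup (false ∷ S) zero    = refl
∈ˢ?-lookup (_     ∷ S) (suc i) = ∈ˢ?-lookup S i

isMinimum-unique : {P : ℕ → Set} {j k : ℕ} → IsMinimum P j → IsMinimum P k → j ≡ k
isMinimum-unique (pj , j≤) (pk , k≤) = ≤-antisym (j≤ pk) (k≤ pj)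

module Transfer {T : RootedGraph} (iso : Isometry δ ℓ T) where
  open RootedGraph T hiding (dimₘₛ)
  open Isometry iso

  record Matches (S : Subset order) (s : NodeSet δ ℓ) : Set where
    constructor matches
    field lookup≡ : ∀ u → lookupᵛ S (f u) ≡ s u

  pull : Subset order → NodeSet δ ℓ
  pull S u = lookupᵛ S (f u)

  push : NodeSet δ ℓ → Subset order
  push s = tabulateᵛ (s ∘ g)

  pull-matches : ∀ S → Matches S (pull S)
  pull-matches S = matches λ _ → refl

  push-matches : ∀ s → Matches (push s) s
  push-matches s = matches λ u → trans (lookup∘tabulate (s ∘ g) (f u)) (cong s (g∘f u))

  module _ {S : Subset order} {s : NodeSet δ ℓ} (S~s : Matches S s) where
    open Matches S~s

    elements-↭ : elements S ↭ map f (elems s)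
    elements-↭ = unique-↭ (Uniqueₚ.filter⁺ (_∈ˢ? S) (Uniqueₚ.allFin⁺ order))
                   (Uniqueₚ.map⁺ f-injective (elems-unique s)) to from
      where
      to : ∀ {v} → v ∈ elements S → v ∈ map f (elems s)
      to {v} v∈ = subst (_∈ map f (elems s)) (f∘g v) (∈-map⁺ f (∈-elems⁺ s (g v)
        (trans (sym (lookup≡ (g v))) (trans (cong (lookupᵛ S) (f∘g v))
          ([]=⇒lookup (proj₂ (∈-filter⁻ (_∈ˢ? S) {xs = allFin order} v∈)))))))
      from : ∀ {v} → v ∈ map f (elems s) → v ∈ elements S
      from v∈ with ∈-map⁻ f v∈
      ... | u , u∈ , refl = ∈-filter⁺ (_∈ˢ? S) (∈-allFin (f u))
              (lookup⇒[]= (f u) S (trans (lookup≡ u) (∈-elems⁻ s u∈)))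

    representation-↭ : ∀ u → m⟨ f u ∣ S ⟩ ↭ rep u s
    representation-↭ u = ↭-trans (map⁺ (d (f u)) elements-↭)
      (↭-reflexive (trans (sym (map-∘ (elems s))) (map-cong (d-f u) (elems s))))

    size-∣∣ : ∣ S ∣ ≡ size s
    size-∣∣ = trans (sym (length-filter-tabulate (_∈ˢ? S) (λ i → i) S (∈ˢ?-lookup S)))
      (trans (↭-length elements-↭) (length-map f (elems s)))

    resolving⁺ : OuterMultisetResolving S → Resolving s
    resolving⁺ res u v u∉ v∉ u≢v p = res (f u) (f v) (outside u u∉) (outside v v∉)
      (u≢v ∘ f-injective)
      (↭-trans (representation-↭ u) (↭-trans p (↭-sym (representation-↭ v))))
      where
      outside : ∀ u → s u ≡ false → f u ∉ˢ S
      outside u u∉ u∈ = case trans (sym u∉) (trans (sym (lookup≡ u)) ([]=⇒lookup u∈)) of λ ()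

    resolving⁻ : Resolving s → OuterMultisetResolving S
    resolving⁻ res u v u∉ v∉ u≢v p = res (g u) (g v) (outside u u∉) (outside v v∉)
      (λ eq → u≢v (trans (sym (f∘g u)) (trans (cong f eq) (f∘g v))))
      (↭-trans (↭-sym (representation-↭ (g u))) (↭-trans
        (subst₂ (λ x y → m⟨ x ∣ S ⟩ ↭ m⟨ y ∣ S ⟩) (sym (f∘g u)) (sym (f∘g v)) p)
        (representation-↭ (g v))))
      where
      outside : ∀ v → v ∉ˢ S → s (g v) ≡ false
      outside v v∉ = ¬-not λ eq → v∉ (lookup⇒[]= v S
        (trans (cong (lookupᵛ S) (sym (f∘g v))) (trans (lookup≡ (g v)) eq)))

  dim-≡ : (∀ s → Resolving s → D ≤ size s) → (s : NodeSet δ ℓ) → Resolving s → size s ≡ D →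
          dimₘₛ T ≡ D
  dim-≡ {D} lower s res size≡ = isMinimum-unique (proj₂ dimₘₛ-minimum)
    ((push s , resolving⁻ (push-matches s) res , trans (size-∣∣ (push-matches s)) size≡) ,
     λ { (S , resS , refl) → subst (D ≤_) (sym (size-∣∣ (pull-matches S)))
           (lower (pull S) (resolving⁺ (pull-matches S) resS)) })

  dim-≤ : ∀ s → Resolving s → dimₘₛ T ≤ size s
  dim-≤ s res = proj₂ (proj₂ dimₘₛ-minimum)
    (push s , resolving⁻ (push-matches s) res , size-∣∣ (push-matches s))

  -- A leaf attains ℓ, and the isometry bounds every distance from the root by the length of a word.
  ε-root : IsFullTree δ ℓ T → ε root ≡ ℓ
  ε-root full with IsFullTree.leaf-exists full
  ... | v , leaf = max≈v⁺ {xs = map (d root) (allFin order)}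
    (subst (_∈ map (d root) (allFin order)) (IsFullTree.leaf-depth full v leaf)
      (∈-map⁺ (d root) (∈-allFin v)))
    (Allₚ.map⁺ (All.universal bound (allFin order))) z≤n
    where
    bound : ∀ v → d root v ≤ ℓ
    bound v = subst (_≤ ℓ) (trans (sym (d-f top (g v))) (cong₂ d f-top (f∘g v))) (depth≤ (g v))

  leaves-≡ : IsFullTree δ ℓ T → ∀ S → m⟨ root ∣ S ⟩ ⟦ ε root ⟧ ≡ leaves (pull S)
  leaves-≡ full S = trans (cong₂ (λ w k → m⟨ w ∣ S ⟩ ⟦ k ⟧) (sym f-top) (ε-root full))
    (⟦⟧-↭ ℓ (representation-↭ (pull-matches S) top))

-- For δ = 1 the tree is a path, and either end vertex alone is a basis.

onlyTop : NodeSet δ ℓ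
onlyTop top     = true
onlyTop (_ ▸ _) = false

elems-onlyTop : elems (onlyTop {δ} {ℓ}) ↭ [ top ]
elems-onlyTop = unique-↭ (elems-unique onlyTop) ([] ∷ []) to
  λ { (here refl) → ∈-elems⁺ onlyTop top refl }
  where
  to : {u : Node δ ℓ} → u ∈ elems onlyTop → u ∈ [ top ]
  to {u = top}   _  = here refl
  to {u = _ ▸ _} u∈ = case ∈-elems⁻ onlyTop u∈ of λ ()

depth-injective : (u v : Node 1 ℓ) → depth u ≡ depth v → u ≡ v
depth-injective top        top        _  = refl
depth-injective (zero ▸ u) (zero ▸ v) eq = cong (zero ▸_) (depth-injective u v (suc-injective eq))

dist-top : (u : Node δ ℓ) → dist u top ≡ depth u
dist-top top     = refl
dist-top (_ ▸ _) = refl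

onlyTop-resolving : Resolving (onlyTop {1} {ℓ})
onlyTop-resolving u v _ _ u≢v p = u≢v (depth-injective u v (trans (sym (dist-top u))
  (trans (∷-injectiveˡ (↭-singleton-inv (↭-trans (↭-sym (rep≡ u)) (↭-trans p (rep≡ v))))) (dist-top v))))
  where
  rep≡ : ∀ u → rep u onlyTop ↭ [ dist u top ]
  rep≡ u = map⁺ (dist u) elems-onlyTop

-- With nothing chosen all representations are empty, and `top` and its first child are two vertices
-- that are not separated.
resolving-nonempty : (s : NodeSet (suc δ) (suc ℓ)) → Resolving s → 1 ≤ size s
resolving-nonempty s res = n≢0⇒n>0 (nonempty (elems s) refl)
  where
  nonempty : ∀ xs → elems s ≡ xs → length xs ≢ 0
  nonempty [] eq _ = res top (zero ▸ top) (outside top) (outside (zero ▸ top)) (λ ())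
    (↭-reflexive (trans (rep≡[] top) (sym (rep≡[] (zero ▸ top)))))
    where
    outside : ∀ u → s u ≡ false
    outside u = ¬-not λ u∈ → case subst (u ∈_) eq (∈-elems⁺ s u u∈) of λ ()
    rep≡[] : ∀ u → rep u s ≡ []
    rep≡[] u = cong (map (dist u)) eq

dim-path : {T : RootedGraph} → IsFullTree 1 (suc ℓ) T → dimₘₛ T ≡ 1
dim-path {ℓ} full = dim-≡ resolving-nonempty onlyTop onlyTop-resolving (↭-length (elems-onlyTop {1} {suc ℓ}))
  where open Transfer (isometry full)

-- The dimension formula

bases⇒distinguished : {T : RootedGraph} → IsFullTree (suc (suc δ)) (suc ℓ) T →
  HasDistinguishingBases (suc (suc δ)) T → Distinguished (suc (suc δ)) (suc ℓ) (dimₘₛ T)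
bases⇒distinguished full (S , bases , distinct) = record
  -- Branching at least 2 and positive depth turn level-resolving sets into resolving ones, so the
  -- dimension bounds their sizes too.
  { least    = λ s res → dim-≤ s (levelResolving⇒resolving s res)
  ; base     = λ i → pull (S i)
  ; resolves = λ i → resolving⇒levelResolving (pull (S i))
                 (resolving⁺ (pull-matches (S i)) (proj₁ (bases i)))
  ; size≡    = λ i → trans (sym (size-∣∣ (pull-matches (S i)))) (proj₂ (bases i))
  ; distinct = λ i j i≢j eq →
                 distinct i j i≢j (trans (leaves-≡ full (S i)) (trans eq (sym (leaves-≡ full (S j)))))
  }
  where open Transfer (isometry full)

distinguished⇒dim : {T : RootedGraph} → IsFullTree (suc (suc δ)) (suc ℓ) T →
  Distinguished (suc (suc δ)) (suc ℓ) D → dimₘₛ T ≡ D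
distinguished⇒dim full dist = dim-≡ (λ s res → least s (resolving⇒levelResolving s res))
  (base zero) (levelResolving⇒resolving (base zero) (resolves zero)) (size≡ zero)
  where
  open Transfer (isometry full)
  open Distinguished dist

theorem5p3 : (δ : ℕ) (T : ℕ → RootedGraph) →
    (∀ ℓ → 1 ≤ ℓ → IsFullTree δ ℓ (T ℓ)) →
    (n : ℕ) →
    IsMinimum (λ m → 1 ≤ m × HasDistinguishingBases δ (T m)) n →
    (ℓ : ℕ) → n ≤ ℓ →
    dimₘₛ (T ℓ) ≡ δ ^ (ℓ ∸ n) * dimₘₛ (T n)
-- A leaf other than the root forces an edge at the root, which excludes δ = 0.
theorem5p3 zero T full n ((1≤n , _) , _) ℓ n≤ℓ = ⊥-elim (n≮0 (0<δ (full n 1≤n)))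
-- Both dimensions are 1, and so is every power of 1.
theorem5p3 (suc zero) T full (suc n) ((1≤n , _) , _) (suc ℓ) n≤ℓ =
  trans (dim-path (full (suc ℓ) (s≤s z≤n)))
    (sym (cong₂ _*_ (^-zeroˡ (ℓ ∸ n)) (dim-path (full (suc n) 1≤n))))
theorem5p3 (suc (suc δ)) T full (suc n) ((1≤n , bases) , _) (suc ℓ) n≤ℓ =
  distinguished⇒dim (full (suc ℓ) (s≤s z≤n))
    (subst (λ m → Distinguished (suc (suc δ)) m (suc (suc δ) ^ (ℓ ∸ n) * dimₘₛ (T (suc n)))) (m∸n+n≡m n≤ℓ)
      (distinguished-+ (ℓ ∸ n) (bases⇒distinguished (full (suc n) 1≤n) bases)))
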